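{- Let $\mathcal{G}=(G,\odot,\leq)$ be an alo-group with identity element $e$, let $C=[c_{ij}]$ be an $n\times n$ $\odot$-reciprocal PC matrix with entries in $G$, let $w=[w(a_1),\ldots,w(a_n)]^T$ be a priority vector with $w(a_1),\ldots,w(a_n)\in G$, and let $i,j,k,l\in\{1,\ldots,n\}$. If \[ c_{ij}>\mathscr{E}(C,w),\qquad c_{kl}>\mathscr{E}(C,w), \] and \[ c_{ij}\div c_{kl}>\mathscr{E}(C,w)\odot\mathscr{E}(C,w), \] then \[ w(a_i)>w(a_j),\qquad w(a_k)>w(a_l), \] and \[ w(a_i)\div w(a_j)>w(a_k)\div w(a_l). \]
   Context: An abelian linearly ordered group (alo-group) is a triple $\mathcal{G}=(G,\odot,\leq)$ where $(G,\odot)$ is an abelian group with identity element $e$, $\leq$ is a linear order on $G$, and $a\leq b$ implies $a\odot c\leq b\odot c$ for all $a,b,c\in G$. The inverse of $a$ is denoted $a^{(-1)}$, and $a\div b=a\odot b^{(-1)}$. A PC (pairwise comparisons) matrix over $\mathcal{G}$ is an $n\times n$ matrix $C=[c_{ij}]$ with $c_{ij}\in G$; the entry $c_{ij}$ is the comparison of alternative $a_i$ with alternative $a_j$. $C$ is $\odot$-reciprocal if $c_{ij}\odot c_{ji}=e$ for all $i,j\in\{1,\ldots,n\}$. A priority vector is an arbitrary vector $w=[w(a_1),\ldots,w(a_n)]^T$ of elements of $G$ (weights of the alternatives $a_1,\ldots,a_n$); no particular method of generating $w$ from $C$ and no normalization is assumed. The local error index is $\epsilon(i,j,w)=c_{ij}\odot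 w(a_j)\div w(a_i)$, i.e. $c_{ij}\odot w(a_j)\odot w(a_i)^{(-1)}$. Put $\mathscr{E}(i,j,w)=\max\{\epsilon(i,j,w),(\epsilon(i,j,w))^{(-1)}\}$. The global error index is $\mathscr{E}(C,w)=\max_{i,j\in\{1,\ldots,n\}}\mathscr{E}(i,j,w)$. -}

module Defs where

open import Algebra.Bundles using (AbelianGroup)
open import Algebra.Core using (Op₁; Op₂)
open import Algebra.Structures using (IsAbelianGroup)
open import Data.Nat.Base using (ℕ; suc; NonZero)
open import Data.Vec.Functional using (Vector; head; tail; toList)
open import Level using (Level) renaming (suc to lsuc; _⊔_ to _⊔ˡ_)
open import Relation.Binary.Bundles using (TotalOrder)
open import Relation.Binary.Core using (Rel)
open import Relation.Binary.Structures using (IsTotalOrder)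
import Algebra.Construct.NaturalChoice.Max as BinaryMax
import Data.List.Extrema as Extrema
import Relation.Binary.Construct.NonStrictToStrict as NonStrictToStrict

-- The group and the order share the setoid equality _≈_, so antisymmetry
-- and the compatibility of all operations are with respect to _≈_.
record AloGroup (c ℓ₁ ℓ₂ : Level) : Set (lsuc (c ⊔ˡ ℓ₁ ⊔ˡ ℓ₂)) where
  infix  8 _⁻¹
  infixl 7 _⊙_
  infix  4 _≈_ _≤_ _>_
  field
    Carrier        : Set c
    _≈_            : Rel Carrier ℓ₁
    _≤_            : Rel Carrier ℓ₂
    _⊙_            : Op₂ Carrier
    e              : Carrier
    _⁻¹            : Op₁ Carrier
    isAbelianGroup : IsAbelianGroup _≈_ _⊙_ e _⁻¹
    isTotalOrder   : IsTotalOrder _≈_ _≤_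
    ⊙-monoˡ-≤      : ∀ {a b} c → a ≤ b → a ⊙ c ≤ b ⊙ c

  abelianGroup : AbelianGroup c ℓ₁
  abelianGroup = record { isAbelianGroup = isAbelianGroup }

  totalOrder : TotalOrder c ℓ₁ ℓ₂
  totalOrder = record { isTotalOrder = isTotalOrder }

  infixl 6 _÷_
  _÷_ : Op₂ Carrier
  a ÷ b = a ⊙ b ⁻¹

  open NonStrictToStrict _≈_ _≤_ public using (_<_)

  _>_ : Rel Carrier (ℓ₁ ⊔ˡ ℓ₂)
  a > b = b < a

module PairwiseComparisons {c ℓ₁ ℓ₂ : Level} (𝓖 : AloGroup c ℓ₁ ℓ₂) where
  open AloGroup 𝓖
  open BinaryMax totalOrder using (_⊔_)
  open Extrema totalOrder using (max)

  PCMatrix : ℕ → Set c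
  PCMatrix n = Vector (Vector Carrier n) n

  PriorityVector : ℕ → Set c
  PriorityVector n = Vector Carrier n

  Reciprocal : {n : ℕ} → PCMatrix n → Set ℓ₁
  Reciprocal C = ∀ i j → C i j ⊙ C j i ≈ e

  -- The library's max takes a default value as well as a list; using the
  -- first entry for it gives the maximum of the entries alone.
  maximum : {n : ℕ} .{{_ : NonZero n}} → Vector Carrier n → Carrier
  maximum {suc n} xs = max (head xs) (toList (tail xs))

  module _ {n : ℕ} (C : PCMatrix n) (w : PriorityVector n) where

    localErrorIndex : Vector (Vector Carrier n) n
    localErrorIndex i j = C i j ⊙ w j ÷ w i

    symmetricError : Vector (Vector Carrier n) n
    symmetricError i j = localErrorIndex i j ⊔ localErrorIndex i j ⁻¹

    globalErrorIndex : .{{_ : NonZero n}} → Carrier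
    globalErrorIndex = maximum λ i → maximum λ j → symmetricError i j

{-# OPTIONS --safe #-}

-- Write E for the global error index. Both ε(i,j,w) ≤ E and ε(k,l,w)⁻¹ ≤ E, so
-- c_ij ≤ E ⊙ (w_i ÷ w_j) and w_k ÷ w_l ≤ E ⊙ c_kl. From E < c_ij the first bound
-- gives w_j < w_i on cancelling E, and the two bounds together with
-- E ⊙ E ⊙ c_kl < c_ij give E ⊙ (w_k ÷ w_l) < E ⊙ (w_i ÷ w_j).

module Submission where

open import Defs
open import Algebra.Bundles using (AbelianGroup)
open import Data.Fin.Base using (Fin; zero; suc)
open import Data.List.Relation.Unary.All.Properties using (tabulate⁻)
open import Data.Nat.Base using (ℕ; suc; NonZero)
open import Data.Product.Base using (_×_; _,_)
open import Data.Vec.Functional using (Vector; head; tail; toList)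
open import Level using (Level)
open import Relation.Binary.Bundles using (TotalOrder)
import Algebra.Construct.NaturalChoice.Max as BinaryMax
import Algebra.Properties.AbelianGroup as AbelianGroupProperties
import Data.List.Extrema as Extrema
import Relation.Binary.Reasoning.PartialOrder as PartialOrderReasoning

module AloGroupProperties {c ℓ₁ ℓ₂ : Level} (𝓖 : AloGroup c ℓ₁ ℓ₂) where
  open AloGroup 𝓖
  open AbelianGroup abelianGroup using (comm; ∙-congʳ)
  open AbelianGroupProperties abelianGroup
    using (∙-cancelʳ; //-rightDividesˡ; //-rightDividesʳ)
  open PartialOrderReasoning (TotalOrder.poset totalOrder)

  ⊙-monoʳ-≤ : ∀ {a b} c → a ≤ b → c ⊙ a ≤ c ⊙ b
  ⊙-monoʳ-≤ {a} {b} c a≤b = begin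
    c ⊙ a ≈⟨ comm c a ⟩
    a ⊙ c ≤⟨ ⊙-monoˡ-≤ c a≤b ⟩
    b ⊙ c ≈⟨ comm b c ⟩
    c ⊙ b ∎

  -- Strictness survives because, in a group, an equality of the two products would cancel to an
  -- equality of `a` and `b`.
  ⊙-monoˡ-< : ∀ {a b} c → a < b → a ⊙ c < b ⊙ c
  ⊙-monoˡ-< c (a≤b , a≉b) = ⊙-monoˡ-≤ c a≤b , λ ac≈bc → a≉b (∙-cancelʳ c _ _ ac≈bc)

  ⊙-cancelˡ-< : ∀ c {a b} → c ⊙ a < c ⊙ b → a < b
  ⊙-cancelˡ-< c {a} {b} ca<cb = begin-strict
    a         ≈⟨ //-rightDividesʳ c a ⟨
    a ⊙ c ÷ c ≈⟨ ∙-congʳ (comm a c) ⟩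
    c ⊙ a ÷ c <⟨ ⊙-monoˡ-< (c ⁻¹) ca<cb ⟩
    c ⊙ b ÷ c ≈⟨ ∙-congʳ (comm c b) ⟩
    b ⊙ c ÷ c ≈⟨ //-rightDividesʳ c b ⟩
    b         ∎

  a÷b≤c⇒a≤c⊙b : ∀ {a b c} → a ÷ b ≤ c → a ≤ c ⊙ b
  a÷b≤c⇒a≤c⊙b {a} {b} {c} a÷b≤c = begin
    a           ≈⟨ //-rightDividesˡ b a ⟨
    (a ÷ b) ⊙ b ≤⟨ ⊙-monoˡ-≤ b a÷b≤c ⟩
    c ⊙ b       ∎

module PairwiseComparisonsProperties {c ℓ₁ ℓ₂ : Level} (𝓖 : AloGroup c ℓ₁ ℓ₂) where
  open AloGroup 𝓖
  open PairwiseComparisons 𝓖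
  open AloGroupProperties 𝓖
  open AbelianGroup abelianGroup using (assoc; ∙-congʳ)
  open AbelianGroupProperties abelianGroup
    using (//-rightDividesˡ; //-rightDividesʳ; ⁻¹-anti-homo-//)
  open TotalOrder totalOrder using (poset) renaming (trans to ≤-trans)
  open BinaryMax totalOrder using (x≤x⊔y; x≤y⊔x)
  open Extrema totalOrder using (⊥≤max; xs≤max)
  open PartialOrderReasoning poset

  ≤maximum : ∀ {n} .{{_ : NonZero n}} (xs : Vector Carrier n) i → xs i ≤ maximum xs
  -- The first entry is the default value of `max` and not a member of its list, so it needs the
  -- bound for the default; the other entries come from the tail.
  ≤maximum {suc n} xs zero    = ⊥≤max (head xs) (toList (tail xs))
  ≤maximum {suc n} xs (suc i) = tabulate⁻ (xs≤max (head xs) (toList (tail xs))) i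

  module _ {n : ℕ} .{{_ : NonZero n}} (C : PCMatrix n) (w : PriorityVector n) where

    private
      E = globalErrorIndex C w

    -- The maximum is nested: the entry is bounded by the maximum of row `i`, which is in turn
    -- bounded by the maximum over all rows.
    symmetricError≤globalErrorIndex : ∀ i j → symmetricError C w i j ≤ E
    symmetricError≤globalErrorIndex i j =
      ≤-trans (≤maximum (symmetricError C w i) j)
              (≤maximum (λ i → maximum (symmetricError C w i)) i)

    -- This is the half ε(i,j,w) ≤ `E` of the error bound, with the denominator `w i` cleared.
    entry⊙weight≤ : ∀ i j → C i j ⊙ w j ≤ E ⊙ w i
    entry⊙weight≤ i j = a÷b≤c⇒a≤c⊙b
      (≤-trans (x≤x⊔y _ _) (symmetricError≤globalErrorIndex i j))

    entry≤ : ∀ i j → C i j ≤ E ⊙ (w i ÷ w j)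
    entry≤ i j = begin
      C i j             ≈⟨ //-rightDividesʳ (w j) (C i j) ⟨
      C i j ⊙ w j ÷ w j ≤⟨ ⊙-monoˡ-≤ (w j ⁻¹) (entry⊙weight≤ i j) ⟩
      E ⊙ w i ÷ w j     ≈⟨ assoc E (w i) (w j ⁻¹) ⟩
      E ⊙ (w i ÷ w j)   ∎

    -- The other half, ε(i,j,w)⁻¹ ≤ `E`, bounds the weight ratio from above by the same entry
    -- `C i j`.
    weightRatio≤ : ∀ i j → w i ÷ w j ≤ E ⊙ C i j
    weightRatio≤ i j = begin
      w i ÷ w j               ≤⟨ ⊙-monoˡ-≤ (w j ⁻¹) (a÷b≤c⇒a≤c⊙b inverseError≤) ⟩
      E ⊙ (C i j ⊙ w j) ÷ w j ≈⟨ ∙-congʳ (assoc E (C i j) (w j)) ⟨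
      E ⊙ C i j ⊙ w j ÷ w j   ≈⟨ //-rightDividesʳ (w j) (E ⊙ C i j) ⟩
      E ⊙ C i j               ∎
      where
      inverseError≤ : w i ÷ (C i j ⊙ w j) ≤ E
      inverseError≤ = begin
        -- Inverting a quotient swaps its two terms, so this is the inverse of the local error.
        w i ÷ (C i j ⊙ w j)        ≈⟨ ⁻¹-anti-homo-// (C i j ⊙ w j) (w i) ⟨
        localErrorIndex C w i j ⁻¹ ≤⟨ x≤y⊔x _ _ ⟩
        symmetricError C w i j     ≤⟨ symmetricError≤globalErrorIndex i j ⟩
        E                          ∎

    preservesPreference : ∀ i j → C i j > E → w i > w j
    preservesPreference i j Cij>E = ⊙-cancelˡ-< E (begin-strict
      E ⊙ w j     <⟨ ⊙-monoˡ-< (w j) Cij>E ⟩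
      C i j ⊙ w j ≤⟨ entry⊙weight≤ i j ⟩
      E ⊙ w i     ∎)

    -- Each factor of `E ⊙ E` pays for one exchange: `w k ÷ w l` for `C k l`, and `C i j` for
    -- `w i ÷ w j`.
    preservesIntensity : ∀ i j k l → C i j ÷ C k l > E ⊙ E → w i ÷ w j > w k ÷ w l
    preservesIntensity i j k l ratio>E² = ⊙-cancelˡ-< E (begin-strict
      -- The leading `E` is there to be cancelled against the one that `entry≤ i j` brings in at the
      -- end of the chain.
      E ⊙ (w k ÷ w l)         ≤⟨ ⊙-monoʳ-≤ E (weightRatio≤ k l) ⟩
      E ⊙ (E ⊙ C k l)         ≈⟨ assoc E E (C k l) ⟨
      E ⊙ E ⊙ C k l           <⟨ ⊙-monoˡ-< (C k l) ratio>E² ⟩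
      (C i j ÷ C k l) ⊙ C k l ≈⟨ //-rightDividesˡ (C k l) (C i j) ⟩
      C i j                   ≤⟨ entry≤ i j ⟩
      E ⊙ (w i ÷ w j)         ∎)

theorem2 : {c ℓ₁ ℓ₂ : Level} (𝓖 : AloGroup c ℓ₁ ℓ₂) →
  let open AloGroup 𝓖
      open PairwiseComparisons 𝓖
  in {n : ℕ} .{{_ : NonZero n}} (C : PCMatrix n) → Reciprocal C →
     (w : PriorityVector n) (i j k l : Fin n) →
     C i j > globalErrorIndex C w →
     C k l > globalErrorIndex C w →
     C i j ÷ C k l > globalErrorIndex C w ⊙ globalErrorIndex C w →
     (w i > w j) × (w k > w l) × (w i ÷ w j > w k ÷ w l)
theorem2 𝓖 C _ w i j k l Cij>E Ckl>E ratio>E² =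
  preservesPreference C w i j Cij>E ,
  preservesPreference C w k l Ckl>E ,
  preservesIntensity C w i j k l ratio>E²
  where open PairwiseComparisonsProperties 𝓖
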